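{- There is an absolute constant $C>0$ such that the following holds. For every positive integer $n$ and every $k\in\{2,\ldots,\lceil n/2\rceil\}$, the polynomial $$q_k(\mathbf{x})=\Big(\sum_{i=1}^n x_i-k\Big)\Big(\sum_{i=1}^n x_i-k+1\Big)$$ has a degree $d$ SoS certificate of nonnegativity over the Boolean hypercube, i.e. $q_k\in\Sigma^{\mathcal{H}}_{n,d}$, for some $d\le C\sqrt{nk}\log(n)$ (that is, the certificate has degree $O(\sqrt{nk}\log n)$).
   Context: For $n\in\mathbb{N}$, $\mathbb{R}[\mathbf{x}]$ denotes real polynomials in $x_1,\ldots,x_n$. $\Sigma_{n,d}$ is the set of finite sums $\sum_i s_i^2$ with $s_i\in\mathbb{R}[\mathbf{x}]$ and $\deg(s_i)\le d$. The Boolean axioms are $\mathcal{H}=\{\pm(x_i^2-x_i): i\in[n]\}$. For a finite set $\mathcal{G}\supseteq\mathcal{H}$ of polynomials, $\Sigma^{\mathcal{G}}_{n,d}$ is the set of polynomials of the form $s_0+\sum_{i} s_i g_i$ (finite sum) with $g_i\in\mathcal{G}$, $s_i\in\Sigma_{n,d}$, and $s_0\in\Sigma_{n,2\lceil(2d+\deg(\mathcal{G}))/2\rceil}$, where $\deg(\mathcal{G})=\max\{\deg g: g\in\mathcal{G}\}$. A polynomial $f$ has a degree $d$ SoS certificate over the Boolean hypercube (is a degree $d$ SoS modulo the Boolean axioms) if $f\in\Sigma^{\mathcal{H}}_{n,d}$. -}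

module Defs where

open import Data.Nat as ℕ using (ℕ; zero; suc; ⌈_/2⌉; _⊔_)
open import Data.Fin using (Fin)
import Data.List
open import Data.List using (List; []; _∷_; map; concatMap)
open import Data.List.Membership.Propositional using (_∈_)
open import Data.List.Relation.Unary.All using (All)
import Data.Product
open import Data.Product using (Σ; ∃; _×_; _,_)
open import Data.List using () renaming (allFin to allFinL)
open import Relation.Binary.PropositionalEquality using (_≡_)
open import Relation.Binary.Structures using (IsTotalOrder)
open import Relation.Nullary using (¬_)
open import Algebra.Structures using (IsCommutativeRing)

-- An axiomatisation of the real numbers: a complete (least-upper-bound)
-- totally ordered field.  All such structures are isomorphic to ℝ.
record RealField : Set₁ where
  infixl 6 _+_
  infixl 7 _*_
  field
    Carrier : Set
    _+_ _*_ : Carrier → Carrier → Carrier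
    -_      : Carrier → Carrier
    0# 1#   : Carrier
    _≤_     : Carrier → Carrier → Set
    isCommutativeRing : IsCommutativeRing _≡_ _+_ _*_ -_ 0# 1#
    0≢1     : ¬ (0# ≡ 1#)
    inverse : ∀ x → ¬ (x ≡ 0#) → ∃ λ y → x * y ≡ 1#
    isTotalOrder : IsTotalOrder _≡_ _≤_
    +-mono-≤ : ∀ {x y} z → x ≤ y → (x + z) ≤ (y + z)
    *-nonneg : ∀ {x y} → 0# ≤ x → 0# ≤ y → 0# ≤ (x * y)
    lub : (P : Carrier → Set) → (∃ λ x → P x) →
          (∃ λ b → ∀ x → P x → x ≤ b) →
          ∃ λ s → (∀ x → P x → x ≤ s) × (∀ b → (∀ x → P x → x ≤ b) → s ≤ b)

module Poly (R : RealField) where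
  open RealField R

  ι : ℕ → Carrier
  ι zero    = 0#
  ι (suc m) = 1# + ι m

  data Poly (n : ℕ) : Set where
    var  : Fin n → Poly n
    con  : Carrier → Poly n
    _⊕_  : Poly n → Poly n → Poly n
    _⊗_  : Poly n → Poly n → Poly n

  -- syntactic degree (an upper bound on the degree of the denoted polynomial;
  -- every polynomial of degree e has a representation of syntactic degree e)
  deg : ∀ {n} → Poly n → ℕ
  deg (var _) = 1
  deg (con _) = 0
  deg (p ⊕ q) = deg p ⊔ deg q
  deg (p ⊗ q) = deg p ℕ.+ deg q

  -- evaluation; polynomials over the infinite field ℝ are identified with
  -- the functions ℝⁿ → ℝ they induce
  ⟦_⟧ : ∀ {n} → Poly n → (Fin n → Carrier) → Carrier
  ⟦ var i ⟧ x = x i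
  ⟦ con c ⟧ x = c
  ⟦ p ⊕ q ⟧ x = ⟦ p ⟧ x + ⟦ q ⟧ x
  ⟦ p ⊗ q ⟧ x = ⟦ p ⟧ x * ⟦ q ⟧ x

  Fun : ℕ → Set
  Fun n = (Fin n → Carrier) → Carrier

  sumL : List Carrier → Carrier
  sumL = Data.List.foldr _+_ 0#

  InSOS : (n d : ℕ) → Fun n → Set
  InSOS n d f = Σ (List (Poly n)) λ ss →
    All (λ s → deg s ℕ.≤ d) ss ×
    (∀ x → f x ≡ sumL (map (λ s → ⟦ s ⟧ x * ⟦ s ⟧ x) ss))

  degList : ∀ {n} → List (Poly n) → ℕ
  degList = Data.List.foldr (λ g m → deg g ⊔ m) 0

  InQM : (n : ℕ) → List (Poly n) → (d : ℕ) → Fun n → Set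
  InQM n G d f = Σ (Fun n) λ s₀ →
    InSOS n (2 ℕ.* ⌈ (2 ℕ.* d ℕ.+ degList G) /2⌉) s₀ ×
    Σ (List (Poly n × Fun n)) λ terms →
      All (λ t → Data.Product.proj₁ t ∈ G × InSOS n d (Data.Product.proj₂ t)) terms ×
      (∀ x → f x ≡ s₀ x + sumL (map (λ t → Data.Product.proj₂ t x * ⟦ Data.Product.proj₁ t ⟧ x) terms))

  bool : ∀ {n} → Fin n → Poly n
  bool i = (var i ⊗ var i) ⊕ (con (- 1#) ⊗ var i)

  H : (n : ℕ) → List (Poly n)
  H n = concatMap (λ i → bool i ∷ (con (- 1#) ⊗ bool i) ∷ []) (allFinL n)

  sumVars : (n : ℕ) → Poly n
  sumVars n = Data.List.foldr _⊕_ (con 0#) (map var (allFinL n))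

  q : (n k : ℕ) → Poly n
  q n k = (sumVars n ⊕ con (- ι k)) ⊗ ((sumVars n ⊕ con (- ι k)) ⊕ con 1#)

{-# OPTIONS --safe #-}

-- Put m = k − 1, t = Σ xᵢ, q = (t − m)(t − m − 1), and let (t)ⱼ be the falling factorial t(t − 1)⋯(t − j + 1);
-- modulo the Boolean axioms it is j! times a sum of squarefree monomials, hence a sum of squares.
-- Descending induction on i certifies q·(t)ᵢ for all i ≤ m.  For i = m it equals (t)ₘ₊₂.  For the step
-- write i + j = m and z = t − i, so that q = (z − j)(z − j − 1) and z·(t)ᵢ = (t)ᵢ₊₁; an identity
-- zτ + qw = const > 0 with τ and w certified then gives  const·q·(t)ᵢ = τ·q·(t)ᵢ₊₁ + w·q²·(t)ᵢ.
-- Such τ and w of degree O(√(n/j)) are built from the Chebyshev polynomials obtained by iterating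
-- u ↦ 4u(1 − u) at u = z/n.  The total degree is O(m + Σ_{j ≤ m} √(n/j)) = O(√(nk)).
module Submission where

open import Algebra.Bundles using (CommutativeRing)
open import Algebra.Solver.Ring.AlmostCommutativeRing using (fromCommutativeRing; _-Raw-AlmostCommutative⟶_)
import Algebra.Properties.AbelianGroup as AbelianGroupProperties
import Algebra.Properties.Ring as RingProperties
import Algebra.Solver.Ring as RingSolver
open import Data.Fin using (Fin)
open import Data.Integer as ℤ using (ℤ; -[1+_])
import Data.Integer.Properties as ℤ
open import Data.List using (List; []; _∷_; map; _++_; foldr; allFin; length)
open import Data.List.Membership.Propositional using (_∈_; lose)
open import Data.List.Membership.Propositional.Properties using (∈-concatMap⁺; ∈-allFin)
open import Data.List.Properties using (map-++; length-tabulate)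
open import Data.List.Relation.Unary.All as All using (All; []; _∷_)
open import Data.List.Relation.Unary.All.Properties using (++⁺)
open import Data.List.Relation.Unary.Any using (here; there)
open import Data.Maybe using (Maybe; just; nothing)
open import Data.Nat as ℕ using (zero; suc; s≤s; z≤n; _≤′_; ≤′-reflexive; ≤′-step)
import Data.Nat.Properties as ℕ
open import Data.Nat.Tactic.RingSolver using () renaming (solve-∀ to ℕ-solve)
open import Data.Product using (_,_; proj₁; proj₂)
import Data.Sign as Sign
open import Data.Sum using (inj₁; inj₂)
open import Function using (id)
open import Level using (0ℓ)
open import Relation.Binary.PropositionalEquality
open import Relation.Binary.Structures using (IsTotalOrder)
open import Relation.Nullary using (¬_; yes; no)

open import Defs
open import Data.Nat using (ℕ; ⌈_/2⌉)
open import Data.Product using (Σ; ∃; _×_)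

-- Ordered-field arithmetic and a ring solver with integer literals.

module OrderedField (R : RealField) where
  open RealField R public
  open Poly R public

  commutativeRing : CommutativeRing 0ℓ 0ℓ
  commutativeRing = record { isCommutativeRing = isCommutativeRing }

  open CommutativeRing commutativeRing public
    using (ring; +-abelianGroup; +-assoc; +-comm; +-identityˡ; +-identityʳ; -‿inverseʳ;
           *-assoc; *-comm; *-identityˡ; *-identityʳ; distribʳ; zeroˡ; zeroʳ; distribˡ)
  open RingProperties ring public using (-‿distribˡ-*; -‿distribʳ-*; -0#≈0#; -‿involutive)
  open AbelianGroupProperties +-abelianGroup public using (⁻¹-∙-comm)

  ι-+ : ∀ m n → ι (m ℕ.+ n) ≡ ι m + ι n
  ι-+ zero    n = sym (+-identityˡ _)
  ι-+ (suc m) n = trans (cong (1# +_) (ι-+ m n)) (sym (+-assoc 1# (ι m) (ι n)))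

  ι-* : ∀ m n → ι (m ℕ.* n) ≡ ι m * ι n
  ι-* zero    n = sym (zeroˡ _)
  ι-* (suc m) n = trans (ι-+ n (m ℕ.* n))
    (trans (cong₂ _+_ (sym (*-identityˡ _)) (ι-* m n)) (sym (distribʳ (ι n) 1# (ι m))))

  -- Differs from ι in that ⌜ 1 ⌝ is 1# on the nose, so that the ring solver reads literals as written.
  ⌜_⌝ : ℕ → Carrier
  ⌜ zero ⌝        = 0#
  ⌜ suc zero ⌝    = 1#
  ⌜ suc (suc n) ⌝ = 1# + ⌜ suc n ⌝

  ⌜⌝≡ι : ∀ n → ⌜ n ⌝ ≡ ι n
  ⌜⌝≡ι zero          = refl
  ⌜⌝≡ι (suc zero)    = sym (+-identityʳ 1#)
  ⌜⌝≡ι (suc (suc n)) = cong (1# +_) (⌜⌝≡ι (suc n))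

  fromℤ : ℤ → Carrier
  fromℤ (ℤ.+ n)  = ⌜ n ⌝
  fromℤ -[1+ n ] = - ⌜ suc n ⌝

  private
    fromℤ-neg : ∀ n → fromℤ -[1+ n ] ≡ - ι (suc n)
    fromℤ-neg n = cong -_ (⌜⌝≡ι (suc n))

    cancel : ∀ a b → (1# + a) + - (1# + b) ≡ a + - b
    cancel a b = begin
      (1# + a) + - (1# + b)       ≡⟨ cong₂ _+_ (+-comm 1# a) (sym (⁻¹-∙-comm 1# b)) ⟩
      (a + 1#) + (- 1# + - b)     ≡⟨ +-assoc a 1# _ ⟩
      a + (1# + (- 1# + - b))     ≡⟨ cong (a +_) (sym (+-assoc 1# (- 1#) (- b))) ⟩
      a + ((1# + - 1#) + - b)     ≡⟨ cong (λ c → a + (c + - b)) (-‿inverseʳ 1#) ⟩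
      a + (0# + - b)              ≡⟨ cong (a +_) (+-identityˡ _) ⟩
      a + - b                     ∎
      where open ≡-Reasoning

    fromℤ-⊖ : ∀ m n → fromℤ (m ℤ.⊖ n) ≡ ι m + - ι n
    fromℤ-⊖ zero    zero    = sym (-‿inverseʳ 0#)
    fromℤ-⊖ zero    (suc n) = trans (fromℤ-neg n) (sym (+-identityˡ _))
    fromℤ-⊖ (suc m) zero    = trans (⌜⌝≡ι (suc m)) (trans (sym (+-identityʳ _)) (cong (ι (suc m) +_) (sym -0#≈0#)))
    fromℤ-⊖ (suc m) (suc n) = trans (cong fromℤ (ℤ.[1+m]⊖[1+n]≡m⊖n m n))
                                (trans (fromℤ-⊖ m n) (sym (cancel (ι m) (ι n))))

    fromℤ-+ : ∀ i j → fromℤ (i ℤ.+ j) ≡ fromℤ i + fromℤ j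
    fromℤ-+ (ℤ.+ m)  (ℤ.+ n)  = trans (⌜⌝≡ι (m ℕ.+ n)) (trans (ι-+ m n) (sym (cong₂ _+_ (⌜⌝≡ι m) (⌜⌝≡ι n))))
    fromℤ-+ (ℤ.+ m)  -[1+ n ] = trans (fromℤ-⊖ m (suc n)) (sym (cong₂ _+_ (⌜⌝≡ι m) (fromℤ-neg n)))
    fromℤ-+ -[1+ m ] (ℤ.+ n)  = trans (fromℤ-⊖ n (suc m)) (trans (+-comm _ _) (sym (cong₂ _+_ (fromℤ-neg m) (⌜⌝≡ι n))))
    fromℤ-+ -[1+ m ] -[1+ n ] = begin
      fromℤ -[1+ suc (m ℕ.+ n) ]      ≡⟨ fromℤ-neg (suc (m ℕ.+ n)) ⟩
      - ι (suc (suc (m ℕ.+ n)))       ≡⟨ cong (λ k → - ι (suc k)) (sym (ℕ.+-suc m n)) ⟩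
      - ι (suc m ℕ.+ suc n)           ≡⟨ cong -_ (ι-+ (suc m) (suc n)) ⟩
      - (ι (suc m) + ι (suc n))       ≡⟨ sym (⁻¹-∙-comm _ _) ⟩
      - ι (suc m) + - ι (suc n)       ≡⟨ sym (cong₂ _+_ (fromℤ-neg m) (fromℤ-neg n)) ⟩
      fromℤ -[1+ m ] + fromℤ -[1+ n ] ∎
      where open ≡-Reasoning

    fromℤ-minus◃ : ∀ n → fromℤ (Sign.- ℤ.◃ n) ≡ - ι n
    fromℤ-minus◃ zero    = sym -0#≈0#
    fromℤ-minus◃ (suc n) = fromℤ-neg n

    fromℤ-plus◃ : ∀ n → fromℤ (Sign.+ ℤ.◃ n) ≡ ι n
    fromℤ-plus◃ zero    = refl
    fromℤ-plus◃ (suc n) = ⌜⌝≡ι (suc n)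

    fromℤ-* : ∀ i j → fromℤ (i ℤ.* j) ≡ fromℤ i * fromℤ j
    fromℤ-* (ℤ.+ m)  (ℤ.+ n)  = trans (fromℤ-plus◃ (m ℕ.* n)) (trans (ι-* m n) (sym (cong₂ _*_ (⌜⌝≡ι m) (⌜⌝≡ι n))))
    fromℤ-* (ℤ.+ m)  -[1+ n ] = begin
      fromℤ (Sign.- ℤ.◃ m ℕ.* suc n) ≡⟨ fromℤ-minus◃ (m ℕ.* suc n) ⟩
      - ι (m ℕ.* suc n)              ≡⟨ cong -_ (ι-* m (suc n)) ⟩
      - (ι m * ι (suc n))            ≡⟨ -‿distribʳ-* _ _ ⟩
      ι m * - ι (suc n)              ≡⟨ sym (cong₂ _*_ (⌜⌝≡ι m) (fromℤ-neg n)) ⟩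
      fromℤ (ℤ.+ m) * fromℤ -[1+ n ] ∎
      where open ≡-Reasoning
    fromℤ-* -[1+ m ] (ℤ.+ n)  = begin
      fromℤ (Sign.- ℤ.◃ suc m ℕ.* n) ≡⟨ fromℤ-minus◃ (suc m ℕ.* n) ⟩
      - ι (suc m ℕ.* n)              ≡⟨ cong -_ (ι-* (suc m) n) ⟩
      - (ι (suc m) * ι n)            ≡⟨ -‿distribˡ-* _ _ ⟩
      - ι (suc m) * ι n              ≡⟨ sym (cong₂ _*_ (fromℤ-neg m) (⌜⌝≡ι n)) ⟩
      fromℤ -[1+ m ] * fromℤ (ℤ.+ n) ∎
      where open ≡-Reasoning
    fromℤ-* -[1+ m ] -[1+ n ] = begin
      fromℤ (Sign.+ ℤ.◃ suc m ℕ.* suc n) ≡⟨ fromℤ-plus◃ (suc m ℕ.* suc n) ⟩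
      ι (suc m ℕ.* suc n)                ≡⟨ ι-* (suc m) (suc n) ⟩
      ι (suc m) * ι (suc n)              ≡⟨ sym (-‿involutive _) ⟩
      - - (ι (suc m) * ι (suc n))        ≡⟨ cong -_ (-‿distribˡ-* _ _) ⟩
      - (- ι (suc m) * ι (suc n))        ≡⟨ -‿distribʳ-* _ _ ⟩
      - ι (suc m) * - ι (suc n)          ≡⟨ sym (cong₂ _*_ (fromℤ-neg m) (fromℤ-neg n)) ⟩
      fromℤ -[1+ m ] * fromℤ -[1+ n ]    ∎
      where open ≡-Reasoning

    fromℤ-‿- : ∀ i → fromℤ (ℤ.- i) ≡ - fromℤ i
    fromℤ-‿- (ℤ.+ zero)  = sym -0#≈0#
    fromℤ-‿- (ℤ.+ suc n) = refl
    fromℤ-‿- -[1+ n ]    = sym (-‿involutive _)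

    ℤ-coefficients : CommutativeRing.rawRing ℤ.+-*-commutativeRing
      -Raw-AlmostCommutative⟶ fromCommutativeRing commutativeRing
    ℤ-coefficients = record
      { ⟦_⟧ = fromℤ ; +-homo = fromℤ-+ ; *-homo = fromℤ-* ; -‿homo = fromℤ-‿- ; 0-homo = refl ; 1-homo = refl }

    fromℤ-≟ : ∀ i j → Maybe (fromℤ i ≡ fromℤ j)
    fromℤ-≟ i j with i ℤ.≟ j
    ... | yes i≡j = just (cong fromℤ i≡j)
    ... | no  _   = nothing

  -- `Carrier` comes without an equality test, so normal forms are computed with integer
  -- coefficients, where like terms can be compared and cancelled.
  module S =
    RingSolver (CommutativeRing.rawRing ℤ.+-*-commutativeRing) (fromCommutativeRing commutativeRing) ℤ-coefficients fromℤ-≟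

  private module ≤ = IsTotalOrder isTotalOrder

  0≤1 : 0# ≤ 1#
  0≤1 with ≤.total 0# 1#
  ... | inj₁ 0≤1 = 0≤1
  ... | inj₂ 1≤0 = subst (0# ≤_) (solve 0 (con -[1+ 0 ] :* con -[1+ 0 ] := con (ℤ.+ 1)) refl) (*-nonneg 0≤-1 0≤-1)
    where
    open S
    0≤-1 : 0# ≤ (- 1#)
    0≤-1 = subst₂ _≤_ (-‿inverseʳ 1#) (+-identityˡ _) (+-mono-≤ (- 1#) 1≤0)

  0≤ι : ∀ n → 0# ≤ ι n
  1≤ι : ∀ n → 1# ≤ ι (suc n)
  0≤ι zero    = ≤.refl
  0≤ι (suc n) = ≤.trans 0≤1 (1≤ι n)
  1≤ι n = subst₂ _≤_ (+-identityˡ 1#) (+-comm _ 1#) (+-mono-≤ 1# (0≤ι n))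

  ι≢0 : ∀ n → ¬ (ι (suc n) ≡ 0#)
  ι≢0 n ι≡0 = 0≢1 (≤.antisym 0≤1 (subst (1# ≤_) ι≡0 (1≤ι n)))

  ι-inverse : ∀ n .{{_ : ℕ.NonZero n}} → ∃ λ ν → ι n * ν ≡ 1#
  ι-inverse (suc n) = inverse (ι (suc n)) (ι≢0 n)

-- The calculus of certificates modulo the Boolean axioms.

module Certificates (R : RealField) where
  open OrderedField R public
  open S public using (Polynomial; con; _:+_; _:*_; _:-_; _:=_; solve)

  lit : ∀ {n} → ℕ → Polynomial n
  lit m = con (ℤ.+ m)

  -- Separating the function from its representative lets ring identities be used pointwise, while
  -- the representative only keeps track of the degree.
  IsPoly : ∀ {n} → ℕ → Fun n → Set
  IsPoly {n} d f = ∃ λ (p : Poly n) → deg p ℕ.≤ d × (∀ x → ⟦ p ⟧ x ≡ f x)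

  infixl 6 _⊞_
  infixl 7 _⊠_

  -- Certificates of degree d modulo the Boolean axioms: the squared polynomials have degree at most d, and
  -- an ideal member p · (xᵢ² − xᵢ) has total degree at most 2d, which is what makes degrees add up in _⊠_.
  data Certified {n : ℕ} (d : ℕ) : Fun n → Set where
    square : ∀ s → deg s ℕ.≤ d → Certified d (λ x → ⟦ s ⟧ x * ⟦ s ⟧ x)
    ideal  : ∀ p i → 2 ℕ.+ deg p ℕ.≤ 2 ℕ.* d → Certified d (λ x → ⟦ p ⟧ x * ⟦ bool i ⟧ x)
    _⊞_    : ∀ {f g} → Certified d f → Certified d g → Certified d (λ x → f x + g x)
    respᶜ  : ∀ {f g} → (∀ x → f x ≡ g x) → Certified d f → Certified d g

  private variable
    n d e : ℕ
    f g : Fun n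

  isSquare : IsPoly d f → Certified d (λ x → f x * f x)
  isSquare (p , p≤d , p≡f) = respᶜ (λ x → cong₂ _*_ (p≡f x) (p≡f x)) (square p p≤d)

  weaken : d ℕ.≤ e → Certified d f → Certified e f
  weaken d≤e (square s s≤d)  = square s (ℕ.≤-trans s≤d d≤e)
  weaken d≤e (ideal p i p≤d) = ideal p i (ℕ.≤-trans p≤d (ℕ.*-monoʳ-≤ 2 d≤e))
  weaken d≤e (F ⊞ G)         = weaken d≤e F ⊞ weaken d≤e G
  weaken d≤e (respᶜ f≡g F)   = respᶜ f≡g (weaken d≤e F)

  cast : d ≡ e → Certified d f → Certified e f
  cast d≡e = weaken (ℕ.≤-reflexive d≡e)

  private
    square-ideal-degree : ∀ {s p} d e → s ℕ.≤ d → 2 ℕ.+ p ℕ.≤ 2 ℕ.* e →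
      2 ℕ.+ (s ℕ.+ s ℕ.+ p) ℕ.≤ 2 ℕ.* (d ℕ.+ e)
    square-ideal-degree {s} {p} d e s≤d p≤e =
      subst₂ ℕ._≤_ (lhs s p) (rhs d e) (ℕ.+-mono-≤ (ℕ.+-mono-≤ s≤d s≤d) p≤e)
      where
      lhs : ∀ s p → s ℕ.+ s ℕ.+ (2 ℕ.+ p) ≡ 2 ℕ.+ (s ℕ.+ s ℕ.+ p)
      lhs = ℕ-solve
      rhs : ∀ d e → d ℕ.+ d ℕ.+ 2 ℕ.* e ≡ 2 ℕ.* (d ℕ.+ e)
      rhs = ℕ-solve

    ideal-ideal-degree : ∀ {p p′} d e → 2 ℕ.+ p ℕ.≤ 2 ℕ.* d → 2 ℕ.+ p′ ℕ.≤ 2 ℕ.* e →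
      2 ℕ.+ (p ℕ.+ (p′ ℕ.+ 2)) ℕ.≤ 2 ℕ.* (d ℕ.+ e)
    ideal-ideal-degree {p} {p′} d e p≤d p′≤e =
      subst₂ ℕ._≤_ (lhs p p′) (sym (ℕ.*-distribˡ-+ 2 d e)) (ℕ.+-mono-≤ p≤d p′≤e)
      where
      lhs : ∀ p p′ → 2 ℕ.+ p ℕ.+ (2 ℕ.+ p′) ≡ 2 ℕ.+ (p ℕ.+ (p′ ℕ.+ 2))
      lhs = ℕ-solve

  -- Distributivity reduces to products of two generators. Two squares give a square; in the other
  -- three cases one factor `bool i` is kept and all the rest becomes its coefficient, of total
  -- degree at most 2d + 2e.
  _⊠_ : Certified d f → Certified e g → Certified (d ℕ.+ e) (λ x → f x * g x)
  respᶜ f≡g F ⊠ G = respᶜ (λ x → cong (_* _) (f≡g x)) (F ⊠ G)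
  (F ⊞ F′) ⊠ G = respᶜ (λ x → sym (distribʳ _ _ _)) ((F ⊠ G) ⊞ (F′ ⊠ G))
  F@(square _ _) ⊠ respᶜ f≡g G = respᶜ (λ x → cong (_ *_) (f≡g x)) (F ⊠ G)
  F@(ideal _ _ _) ⊠ respᶜ f≡g G = respᶜ (λ x → cong (_ *_) (f≡g x)) (F ⊠ G)
  F@(square _ _) ⊠ (G ⊞ G′) = respᶜ (λ x → sym (distribˡ _ _ _)) ((F ⊠ G) ⊞ (F ⊠ G′))
  F@(ideal _ _ _) ⊠ (G ⊞ G′) = respᶜ (λ x → sym (distribˡ _ _ _)) ((F ⊠ G) ⊞ (F ⊠ G′))
  square s s≤d ⊠ square t t≤e =
    respᶜ (λ x → solve 2 (λ s t → (s :* t) :* (s :* t) := (s :* s) :* (t :* t)) refl (⟦ s ⟧ x) (⟦ t ⟧ x))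
      (square (s ⊗ t) (ℕ.+-mono-≤ s≤d t≤e))
  _⊠_ {d = d} {e = e} (square s s≤d) (ideal p i p≤e) =
    respᶜ (λ x → *-assoc _ _ _) (ideal ((s ⊗ s) ⊗ p) i (square-ideal-degree d e s≤d p≤e))
  _⊠_ {d = d} {e = e} (ideal p i p≤d) (square s s≤e) =
    respᶜ (λ x → solve 3 (λ s p b → s :* s :* p :* b := p :* b :* (s :* s)) refl (⟦ s ⟧ x) (⟦ p ⟧ x) (⟦ bool i ⟧ x))
      (ideal ((s ⊗ s) ⊗ p) i
        (subst (λ k → 2 ℕ.+ (deg s ℕ.+ deg s ℕ.+ deg p) ℕ.≤ 2 ℕ.* k) (ℕ.+-comm e d) (square-ideal-degree e d s≤e p≤d)))
  _⊠_ {d = d} {e = e} (ideal p i p≤d) (ideal p′ j p′≤e) =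
    respᶜ (λ x → solve 4 (λ p b p′ b′ → p :* (p′ :* b′) :* b := p :* b :* (p′ :* b′)) refl
                    (⟦ p ⟧ x) (⟦ bool i ⟧ x) (⟦ p′ ⟧ x) (⟦ bool j ⟧ x))
      (ideal (p ⊗ (p′ ⊗ bool j)) i (ideal-ideal-degree d e p≤d p′≤e))

  constSquare : ∀ c → Certified {n} 0 (λ _ → c * c)
  constSquare c = square (con c) z≤n

  natural : ∀ m → Certified {n} 0 (λ _ → ι m)
  natural zero    = respᶜ (λ _ → zeroˡ 0#) (constSquare 0#)
  natural (suc m) = respᶜ (λ _ → cong (_+ ι m) (*-identityˡ 1#)) (constSquare 1# ⊞ natural m)

  -- Writing ν = m · ν² exhibits it as a sum of squares of constants without extracting a square
  -- root.
  reciprocal : ∀ m {ν} → ι m * ν ≡ 1# → Certified {n} 0 (λ _ → ν)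
  reciprocal m {ν} mν≡1 =
    respᶜ (λ _ → trans (sym (*-assoc (ι m) ν ν)) (trans (cong (_* ν) mν≡1) (*-identityˡ ν))) (natural m ⊠ constSquare ν)

  divide : ∀ m .{{_ : ℕ.NonZero m}} → Certified d (λ x → ι m * f x) → Certified d f
  divide {f = f} m F with ι-inverse m
  ... | ν , mν≡1 = respᶜ (λ x → trans (solve 3 (λ ν m y → ν :* (m :* y) := m :* ν :* y) refl ν (ι m) (f x))
                                 (trans (cong (_* f x) mν≡1) (*-identityˡ _)))
                     (reciprocal m mν≡1 ⊠ F)

  -- From certificates to membership in the quadratic module.

  sumL-++ : ∀ xs ys → sumL (xs ++ ys) ≡ sumL xs + sumL ys
  sumL-++ []       ys = sym (+-identityˡ _)
  sumL-++ (x ∷ xs) ys = trans (cong (x +_) (sumL-++ xs ys)) (sym (+-assoc x _ _))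

  private
    sumL-map-++ : ∀ {A : Set} (h : A → Carrier) xs ys → sumL (map h (xs ++ ys)) ≡ sumL (map h xs) + sumL (map h ys)
    sumL-map-++ h xs ys = trans (cong sumL (map-++ h xs ys)) (sumL-++ (map h xs) (map h ys))

    Decomposition : ℕ → Fun n → Set
    Decomposition {n} d f =
      Σ (List (Poly n)) λ ss → All (λ s → deg s ℕ.≤ d) ss ×
      Σ (List (Poly n × Fun n)) λ ts → All (λ t → proj₁ t ∈ H n × InSOS n (2 ℕ.* d) (proj₂ t)) ts ×
      (∀ x → f x ≡ sumL (map (λ s → ⟦ s ⟧ x * ⟦ s ⟧ x) ss) + sumL (map (λ t → proj₂ t x * ⟦ proj₁ t ⟧ x) ts))

    half : ∃ λ ½ → ι 2 * ½ ≡ 1#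
    half = ι-inverse 2

    singleton : ∀ (s : Poly n) → deg s ℕ.≤ d → InSOS n d (λ x → ⟦ s ⟧ x * ⟦ s ⟧ x)
    singleton s s≤d = (s ∷ []) , (s≤d ∷ []) , λ x → sym (+-identityʳ _)

    bool∈H : ∀ (i : Fin n) → bool i ∈ H n
    bool∈H i = ∈-concatMap⁺ _ (lose (∈-allFin i) (here refl))

    -bool∈H : ∀ (i : Fin n) → (con (- 1#) ⊗ bool i) ∈ H n
    -bool∈H i = ∈-concatMap⁺ _ (lose (∈-allFin i) (there (here refl)))

    decompose : Certified {n} d f → Decomposition d f
    decompose (square s s≤d) = (s ∷ []) , (s≤d ∷ []) , [] , [] , λ x →
      solve 1 (λ s → s := s :+ lit 0 :+ lit 0) refl (⟦ s ⟧ x * ⟦ s ⟧ x)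
    -- With h = xᵢ² - xᵢ, the identity p · h = ((p + 1)/2)² · h + ((p - 1)/2)² · (-h) turns an
    -- arbitrary coefficient into square multipliers of the two axioms ±h.
    decompose {d = d} (ideal p i p≤d) =
      [] , [] , ((bool i , _) ∷ (con (- 1#) ⊗ bool i , _) ∷ []) ,
      ((bool∈H i , singleton (shifted 1#) (bound 1#)) ∷ (-bool∈H i , singleton (shifted (- 1#)) (bound (- 1#))) ∷ []) ,
      λ x → trans (solve 1 (λ y → y := lit 1 :* lit 1 :* y) refl (⟦ p ⟧ x * ⟦ bool i ⟧ x))
        (trans (cong (λ c → c * c * (⟦ p ⟧ x * ⟦ bool i ⟧ x)) (sym two))
      (solve 3 (λ ½ p b → (lit 2 :* ½) :* (lit 2 :* ½) :* (p :* b) :=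
          lit 0 :+ ((½ :* (p :+ lit 1)) :* (½ :* (p :+ lit 1)) :* b
          :+ ((½ :* (p :+ con -[1+ 0 ])) :* (½ :* (p :+ con -[1+ 0 ])) :* (con -[1+ 0 ] :* b) :+ lit 0)))
        refl (proj₁ half) (⟦ p ⟧ x) (⟦ bool i ⟧ x)))
      where
      shifted : Carrier → Poly _
      shifted c = con (proj₁ half) ⊗ (p ⊕ con c)
      bound : ∀ c → deg (shifted c) ℕ.≤ 2 ℕ.* d
      bound c = ℕ.≤-trans (ℕ.≤-reflexive (ℕ.⊔-identityʳ (deg p))) (ℕ.≤-trans (ℕ.m≤n+m (deg p) 2) p≤d)
      two : (1# + 1#) * proj₁ half ≡ 1#
      two = trans (cong (λ c → (1# + c) * proj₁ half) (sym (+-identityʳ 1#))) (proj₂ half)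
    decompose (F ⊞ G) with decompose F | decompose G
    ... | ss , ss≤d , ts , ts∈ , f≡ | ss′ , ss′≤d , ts′ , ts′∈ , g≡ =
      ss ++ ss′ , ++⁺ ss≤d ss′≤d , ts ++ ts′ , ++⁺ ts∈ ts′∈ , λ x →
        trans (cong₂ _+_ (f≡ x) (g≡ x))
          (trans (solve 4 (λ a b c d → (a :+ b) :+ (c :+ d) := (a :+ c) :+ (b :+ d)) refl _ _ _ _)
            (sym (cong₂ _+_ (sumL-map-++ _ ss ss′) (sumL-map-++ _ ts ts′))))
    decompose (respᶜ f≡g F) with decompose F
    ... | ss , ss≤d , ts , ts∈ , f≡ = ss , ss≤d , ts , ts∈ , λ x → trans (sym (f≡g x)) (f≡ x)

  -- The doubling pays for the multipliers (p ± 1)/2, whose degree is bounded only by 2d; the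
  -- squares in the free part have degree at most d and fit easily.
  certified⇒InQM : Certified d f → InQM n (H n) (2 ℕ.* d) f
  certified⇒InQM {d = d} {n = n} F with decompose F
  ... | ss , ss≤d , ts , ts∈ , f≡ = _ , (ss , All.map (λ s≤d → ℕ.≤-trans s≤d d≤) ss≤d , λ x → refl) , ts , ts∈ , f≡
    where
    d≤ : d ℕ.≤ 2 ℕ.* ⌈ (2 ℕ.* (2 ℕ.* d) ℕ.+ degList (H n)) /2⌉
    d≤ = begin
      d                                                        ≤⟨ ℕ.m≤n*m d 2 ⟩
      2 ℕ.* d                                                  ≤⟨ ℕ.m≤n*m (2 ℕ.* d) 2 ⟩
      2 ℕ.* (2 ℕ.* d)                                          ≡⟨ cong (2 ℕ.*_) (ℕ.n≡⌈n+n/2⌉ (2 ℕ.* d)) ⟩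
      2 ℕ.* ⌈ 2 ℕ.* d ℕ.+ 2 ℕ.* d /2⌉                          ≤⟨ ℕ.*-monoʳ-≤ 2 (ℕ.⌈n/2⌉-mono (ℕ.+-monoʳ-≤ (2 ℕ.* d) (ℕ.≤-trans (ℕ.m≤m+n _ 0) (ℕ.m≤m+n _ _)))) ⟩
      2 ℕ.* ⌈ 2 ℕ.* d ℕ.+ (2 ℕ.* d ℕ.+ 0 ℕ.+ degList (H n)) /2⌉ ≡⟨ cong (λ k → 2 ℕ.* ⌈ k /2⌉) (sym (ℕ.+-assoc (2 ℕ.* d) _ _)) ⟩
      2 ℕ.* ⌈ 2 ℕ.* (2 ℕ.* d) ℕ.+ degList (H n) /2⌉            ∎
      where open ℕ.≤-Reasoning

-- Falling factorials of the coordinate sum.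

module SymmetricCertificates (R : RealField) where
  open Certificates R public

  private variable
    n d e : ℕ
    f g : Fun n

  polyConst : ∀ c → IsPoly {n} 0 (λ _ → c)
  polyConst c = con c , z≤n , λ _ → refl

  polyVar : ∀ (i : Fin n) → IsPoly 1 (λ x → x i)
  polyVar i = var i , s≤s z≤n , λ _ → refl

  poly-+ : IsPoly d f → IsPoly e g → IsPoly (d ℕ.⊔ e) (λ x → f x + g x)
  poly-+ (p , p≤d , p≡f) (r , r≤e , r≡g) = p ⊕ r , ℕ.⊔-mono-≤ p≤d r≤e , λ x → cong₂ _+_ (p≡f x) (r≡g x)

  poly-* : IsPoly d f → IsPoly e g → IsPoly (d ℕ.+ e) (λ x → f x * g x)
  poly-* (p , p≤d , p≡f) (r , r≤e , r≡g) = p ⊗ r , ℕ.+-mono-≤ p≤d r≤e , λ x → cong₂ _*_ (p≡f x) (r≡g x)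

  polyWeaken : d ℕ.≤ e → IsPoly d f → IsPoly e f
  polyWeaken d≤e (p , p≤d , p≡f) = p , ℕ.≤-trans p≤d d≤e , p≡f

  polyResp : (∀ x → f x ≡ g x) → IsPoly d f → IsPoly d g
  polyResp f≡g (p , p≤d , p≡f) = p , p≤d , λ x → trans (p≡f x) (f≡g x)

  -- The total degree d + 2 is at most 2(d + 1). This crude bound suffices: `excess j` has degree j
  -- and occurs next to a falling factorial of degree j + 1.
  idealPoly : IsPoly d f → ∀ i → Certified (suc d) (λ x → f x * ⟦ bool i ⟧ x)
  idealPoly {d = d} (p , p≤d , p≡f) i = respᶜ (λ x → cong (_* ⟦ bool i ⟧ x) (p≡f x))
    (ideal p i (subst (2 ℕ.+ deg p ℕ.≤_) (double d) (s≤s (s≤s (ℕ.≤-trans p≤d (ℕ.m≤m+n d d))))))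
    where
    double : ∀ d → 2 ℕ.+ (d ℕ.+ d) ≡ 2 ℕ.* suc d
    double = ℕ-solve

  fall : ℕ → Carrier → Carrier
  fall zero    t = 1#
  fall (suc j) t = (t + - ι j) * fall j t

  -- The remainder in the Vandermonde rule for (x + b)ʲ⁺¹ falling, which drops out when x ∈ {0, 1}.
  excess : ℕ → Carrier → Carrier → Carrier
  excess zero    x b = 0#
  excess (suc j) x b = ι (suc j) * fall j b + (x + b + - ι (suc j)) * excess j x b

  -- The next factor x + b - (j + 1) is split as (b - (j + 1)) + x on the first term and as (b - j)
  -- + (x - 1) on the second; the product x(x - 1) from the latter goes into `excess`.
  fall-+ : ∀ j x b → fall (suc j) b + ι (suc j) * x * fall j b + excess j x b * (x * x + (- 1#) * x) ≡ fall (suc j) (x + b)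
  fall-+ zero x b = solve 2 (λ x b →
    (b :- lit 0) :* lit 1 :+ (lit 1 :+ lit 0) :* x :* lit 1 :+ lit 0 :* (x :* x :+ con -[1+ 0 ] :* x)
    := (x :+ b :- lit 0) :* lit 1) refl x b
  fall-+ (suc j) x b = trans
    (solve 5 (λ x b J F G →
        let J₁ = lit 1 :+ J
            J₂ = lit 1 :+ J₁
            F₁ = (b :- J) :* F
            h  = x :* x :+ con -[1+ 0 ] :* x
        in (b :- J₁) :* F₁ :+ J₂ :* x :* F₁ :+ (J₁ :* F :+ (x :+ b :- J₁) :* G) :* h
           := (x :+ b :- J₁) :* (F₁ :+ J₁ :* x :* F :+ G :* h))
      refl x b (ι j) (fall j b) (excess j x b))
    (cong ((x + b + - ι (suc j)) *_) (fall-+ j x b))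

  fall-suc-0 : ∀ j → fall (suc j) 0# ≡ 0#
  fall-suc-0 zero    = solve 0 ((lit 0 :- lit 0) :* lit 1 := lit 0) refl
  fall-suc-0 (suc j) = trans (cong ((0# + - ι (suc j)) *_) (fall-suc-0 j)) (zeroʳ _)

  varSum : List (Fin n) → Poly n
  varSum is = foldr _⊕_ (con 0#) (map var is)

  private
    deg-varSum : ∀ (is : List (Fin n)) → deg (varSum is) ℕ.≤ 1
    deg-varSum []       = z≤n
    deg-varSum (i ∷ is) = ℕ.⊔-lub ℕ.≤-refl (deg-varSum is)

  polyVarSum : ∀ (is : List (Fin n)) → IsPoly 1 ⟦ varSum is ⟧
  polyVarSum is = varSum is , deg-varSum is , λ _ → refl

  polyFall : ∀ j → IsPoly 1 f → IsPoly j (λ x → fall j (f x))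
  polyFall zero    F = polyConst 1#
  polyFall (suc j) F = poly-* (poly-+ F (polyConst (- ι j))) (polyFall j F)

  polyExcess : ∀ j → IsPoly 1 f → IsPoly 1 g → IsPoly j (λ x → excess j (f x) (g x))
  polyExcess zero    F G = polyConst 0#
  polyExcess (suc j) F G =
    polyWeaken (ℕ.⊔-lub (ℕ.n≤1+n j) ℕ.≤-refl)
      (poly-+ (poly-* (polyConst (ι (suc j))) (polyFall j G))
              (poly-* (poly-+ (poly-+ F G) (polyConst (- ι (suc j)))) (polyExcess j F G)))

  certifiedVar : ∀ (i : Fin n) → Certified 1 (λ x → x i)
  certifiedVar i = respᶜ (λ x → solve 1 (λ x → x :* x :+ con -[1+ 0 ] :* (x :* x :+ con -[1+ 0 ] :* x) := x) refl (x i))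
    (isSquare (polyVar i) ⊞ idealPoly (polyConst (- 1#)) i)

  certifiedCoVar : ∀ (i : Fin n) → Certified 1 (λ x → 1# + - x i)
  certifiedCoVar i =
    respᶜ (λ x → solve 1 (λ x → (lit 1 :+ con -[1+ 0 ] :* x) :* (lit 1 :+ con -[1+ 0 ] :* x)
                               :+ con -[1+ 0 ] :* (x :* x :+ con -[1+ 0 ] :* x) := lit 1 :- x) refl (x i))
      (isSquare (poly-+ (polyConst 1#) (poly-* (polyConst (- 1#)) (polyVar i))) ⊞ idealPoly (polyConst (- 1#)) i)

  -- By `fall-+`, adding a variable produces, up to the ideal, only falling factorials of the
  -- shorter sum with coefficients 1 and (j + 1)xᵢ, which are certified themselves.
  certifiedFall : ∀ (is : List (Fin n)) j → Certified j (λ x → fall j (⟦ varSum is ⟧ x))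
  certifiedFall is       zero    = respᶜ (λ _ → *-identityˡ 1#) (constSquare 1#)
  certifiedFall []       (suc j) = respᶜ (λ _ → sym (fall-suc-0 j)) (weaken z≤n (natural 0))
  certifiedFall (i ∷ is) (suc j) = respᶜ (λ x → fall-+ j (x i) (⟦ varSum is ⟧ x))
    (certifiedFall is (suc j) ⊞ natural (suc j) ⊠ certifiedVar i ⊠ certifiedFall is j
      ⊞ idealPoly (polyExcess j (polyVar i) (polyVarSum is)) i)

  certifiedCoSum : ∀ (is : List (Fin n)) → Certified 1 (λ x → ι (length is) + - ⟦ varSum is ⟧ x)
  certifiedCoSum []       = respᶜ (λ _ → solve 0 (lit 0 := lit 0 :- lit 0) refl) (weaken z≤n (natural 0))
  certifiedCoSum (i ∷ is) = respᶜ (λ x → solve 3 (λ l y s → lit 1 :- y :+ (l :- s) := lit 1 :+ l :- (y :+ s)) refl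
                                            (ι (length is)) (x i) (⟦ varSum is ⟧ x))
    (certifiedCoVar i ⊞ certifiedCoSum is)

  certifiedComplement : Certified 1 (λ x → ι n + - ⟦ sumVars n ⟧ x)
  certifiedComplement {n} = respᶜ (λ x → cong (λ l → ι l + - ⟦ sumVars n ⟧ x) (length-tabulate {n = n} id)) (certifiedCoSum (allFin n))

  -- Chebyshev kernels and the multipliers τ and w.

  module Kernel (ν : Carrier) where

    -- For ν = 1/n, φ r is the r-th iterate of u ↦ 4u(1 − u) at u = z/n, K r = φ r / (4^r u) is the product
    -- of 1 − φ i over i < r, and Q r = (1 − K r) / z.
    a : ℕ → Carrier
    a zero    = ν
    a (suc r) = (1# + 1#) * (1# + 1#) * a r

    K φ Q : ℕ → Carrier → Carrier
    φ r z       = a r * z * K r z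
    K zero    z = 1#
    K (suc r) z = K r z * (1# + - φ r z)
    Q zero    z = 0#
    Q (suc r) z = a r * K r z + (1# + - φ r z) * Q r z

    -- Use 1 - K (r + 1) = φ r + (1 - φ r)(1 - K r): z divides φ r by definition and 1 - K r by
    -- induction.
    z*Q : ∀ r z → z * Q r z ≡ 1# + - K r z
    z*Q zero    z = solve 1 (λ z → z :* lit 0 := lit 1 :- lit 1) refl z
    z*Q (suc r) z = trans
      (solve 4 (λ z a k q → z :* (a :* k :+ (lit 1 :- a :* z :* k) :* q) := a :* z :* k :+ (lit 1 :- a :* z :* k) :* (z :* q))
        refl z (a r) (K r z) (Q r z))
      (trans (cong (λ y → φ r z + (1# + - φ r z) * y) (z*Q r z))
        (solve 2 (λ φ k → φ :+ (lit 1 :- φ) :* (lit 1 :- k) := lit 1 :- k :* (lit 1 :- φ)) refl (φ r z) (K r z)))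

    φ-suc : ∀ r z → (1# + 1#) * (1# + 1#) * (φ r z * (1# + - φ r z)) ≡ φ (suc r) z
    φ-suc r z = solve 4 (λ z a k ψ → lit 2 :* lit 2 :* (a :* z :* k :* ψ) := lit 2 :* lit 2 :* a :* z :* (k :* ψ))
      refl z (a r) (K r z) (1# + - φ r z)

    -- Since 1 - 4φ(1 - φ) = (1 - 2φ)², every 1 - φ r with r > 0 is a perfect square; for r = 0 it
    -- is 1 - z/n, certified through n - z.
    coφ-suc : ∀ r z → (1# + (- (1# + 1#)) * φ r z) * (1# + (- (1# + 1#)) * φ r z) ≡ 1# + - φ (suc r) z
    coφ-suc r z = trans
      (solve 1 (λ φ → (lit 1 :+ con -[1+ 1 ] :* φ) :* (lit 1 :+ con -[1+ 1 ] :* φ) := lit 1 :- lit 2 :* lit 2 :* (φ :* (lit 1 :- φ))) refl (φ r z))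
      (cong (λ y → 1# + - y) (φ-suc r z))

    a≡ : ∀ N → N * ν ≡ 1# → ∀ r → a r * N ≡ ι (4 ℕ.^ r)
    a≡ N Nν≡1 zero    = trans (*-comm ν N) (trans Nν≡1 (sym (+-identityʳ 1#)))
    a≡ N Nν≡1 (suc r) = trans
      (solve 2 (λ a N → lit 2 :* lit 2 :* a :* N := (lit 1 :+ (lit 1 :+ (lit 1 :+ (lit 1 :+ lit 0)))) :* (a :* N)) refl (a r) N)
      (trans (cong (ι 4 *_) (a≡ N Nν≡1 r)) (sym (ι-* 4 (4 ℕ.^ r))))

    module Identity (r : ℕ) (N B J P : Carrier) where

      -- With P = 4^r and B = P²J(J + 1) − N² ≥ 0, the weight w is a multiple of the square of K (suc r) =: K.
      -- Then P²J(J + 1)(1 − K²) + P²(2J + 1)zK² − P²z²K² is divisible by z, and the negative term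
      -- P²z²K² = N²φ²(1 − φ)² is absorbed by the summand φ of 1 − K = φ + (1 − φ)(1 − K r).
      τ w : Carrier → Carrier
      τ z = a r * K r z * (B + N * N * (1# + - φ r z + φ r z * φ r z * (1# + (1# + - φ r z))))
          + P * P * (J * (1# + J)) * (a r * K r z * K (suc r) z + (1# + - φ r z) * Q r z * (1# + K (suc r) z))
          + P * P * (J + (1# + J)) * (K (suc r) z * K (suc r) z)
      w z = P * P * (K (suc r) z * K (suc r) z)

      -- Two substitutions remove z: z · Q r = 1 - K r, and z · P · K (r + 1) = N · φ · (1 - φ)
      -- because P = a r · N. What remains is a polynomial identity in φ r, K r, N and B.
      z*τ+q*w : a r * N ≡ P → P * P * (J * (1# + J)) ≡ N * N + B →
               ∀ z → z * τ z + (z + - J) * (z + - J + - 1#) * w z ≡ P * P * (J * (1# + J))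
      z*τ+q*w aN≡P E≡ z = begin
        z * τ z + (z + - J) * (z + - J + - 1#) * w z
          ≡⟨ solve 10 (λ z J a k q K φ C B P →
               let E = P :* P :* (J :* (lit 1 :+ J)) in
               z :* (a :* k :* (B :+ C)
                     :+ E :* (a :* k :* K :+ (lit 1 :- φ) :* q :* (lit 1 :+ K))
                     :+ P :* P :* (J :+ (lit 1 :+ J)) :* (K :* K))
                  :+ (z :- J) :* (z :- J :- lit 1) :* (P :* P :* (K :* K))
               := (a :* z :* k) :* (B :+ C) :+ E :* (a :* z :* k :* K :+ (lit 1 :- φ) :* (z :* q) :* (lit 1 :+ K))
                  :+ (z :* P :* K) :* (z :* P :* K) :+ E :* (K :* K))
               refl z J (a r) (K r z) (Q r z) (K (suc r) z) (φ r z)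
               (N * N * (1# + - φ r z + φ r z * φ r z * (1# + (1# + - φ r z)))) B P ⟩
        φ r z * (B + C) + E * (φ r z * K (suc r) z + (1# + - φ r z) * (z * Q r z) * (1# + K (suc r) z))
          + (z * P * K (suc r) z) * (z * P * K (suc r) z) + E * (K (suc r) z * K (suc r) z)
          ≡⟨ cong₂ (λ y p → φ r z * (B + C) + E * (φ r z * K (suc r) z + (1# + - φ r z) * y * (1# + K (suc r) z))
                     + p * p + E * (K (suc r) z * K (suc r) z)) (z*Q r z) zPK ⟩
        φ r z * (B + C) + E * (φ r z * K (suc r) z + (1# + - φ r z) * (1# + - K r z) * (1# + K (suc r) z))
          + (N * φ r z * (1# + - φ r z)) * (N * φ r z * (1# + - φ r z)) + E * (K (suc r) z * K (suc r) z)
          ≡⟨ cong (λ E → φ r z * (B + C) + E * (φ r z * K (suc r) z + (1# + - φ r z) * (1# + - K r z) * (1# + K (suc r) z))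
                + (N * φ r z * (1# + - φ r z)) * (N * φ r z * (1# + - φ r z)) + E * (K (suc r) z * K (suc r) z)) E≡ ⟩
        φ r z * (B + C) + (N * N + B) * (φ r z * K (suc r) z + (1# + - φ r z) * (1# + - K r z) * (1# + K (suc r) z))
          + (N * φ r z * (1# + - φ r z)) * (N * φ r z * (1# + - φ r z)) + (N * N + B) * (K (suc r) z * K (suc r) z)
          ≡⟨ solve 4 (λ φ k N B →
               let K = k :* (lit 1 :- φ)
                   p = N :* φ :* (lit 1 :- φ)
                   C = N :* N :* (lit 1 :- φ :+ φ :* φ :* (lit 1 :+ (lit 1 :- φ)))
                   E = N :* N :+ B in
               φ :* (B :+ C) :+ E :* (φ :* K :+ (lit 1 :- φ) :* (lit 1 :- k) :* (lit 1 :+ K)) :+ p :* p :+ E :* (K :* K) := E)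
               refl (φ r z) (K r z) N B ⟩
        N * N + B ≡⟨ sym E≡ ⟩
        E ∎
        where
        open ≡-Reasoning
        E = P * P * (J * (1# + J))
        -- This is N²(1 - φ(1 - φ)²), the part of N² left after absorbing the negative term,
        -- arranged so that only the certified quantities φ² and 1 - φ appear.
        C = N * N * (1# + - φ r z + φ r z * φ r z * (1# + (1# + - φ r z)))
        zPK : z * P * K (suc r) z ≡ N * φ r z * (1# + - φ r z)
        zPK = trans (cong (λ P → z * P * K (suc r) z) (sym aN≡P))
          (solve 5 (λ z a N k ψ → z :* (a :* N) :* (k :* ψ) := N :* (a :* z :* k) :* ψ) refl z (a r) N (K r z) (1# + - φ r z))

    module _ {n : ℕ} {z : Fun n} (z-poly : IsPoly 1 z) (N : ℕ) (Nν≡1 : ι N * ν ≡ 1#) (z≤N : Certified 1 (λ x → ι N + - z x)) where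

      private
        2^suc : ∀ r → 2 ℕ.^ r ℕ.+ 2 ℕ.^ r ≡ 2 ℕ.^ suc r
        2^suc r = cong (2 ℕ.^ r ℕ.+_) (sym (ℕ.+-identityʳ _))

        ≤2^suc : ∀ r → 2 ℕ.^ r ℕ.≤ 2 ℕ.^ suc r
        ≤2^suc r = ℕ.m≤m+n _ _

      poly-φ : ∀ r → IsPoly (2 ℕ.^ r) (λ x → φ r (z x))
      poly-φ zero    = poly-* (poly-* (polyConst ν) z-poly) (polyConst 1#)
      poly-φ (suc r) = polyResp (λ x → φ-suc r (z x))
        (polyWeaken (ℕ.≤-reflexive (2^suc r))
          (poly-* (polyConst ((1# + 1#) * (1# + 1#)))
                  (poly-* (poly-φ r) (polyResp (λ x → solve 1 (λ φ → lit 1 :+ con -[1+ 0 ] :* φ := lit 1 :- φ) refl (φ r (z x)))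
                                      (poly-+ (polyConst 1#) (poly-* (polyConst (- 1#)) (poly-φ r)))))))

      certified-coφ : ∀ r → Certified (2 ℕ.^ r) (λ x → 1# + - φ r (z x))
      certified-coφ zero    = respᶜ
        (λ x → trans (solve 3 (λ ν N z → ν :* (N :- z) := N :* ν :- ν :* z :* lit 1) refl ν (ι N) (z x)) (cong (_+ - φ 0 (z x)) Nν≡1))
        (reciprocal N Nν≡1 ⊠ z≤N)
      certified-coφ (suc r) = respᶜ (λ x → coφ-suc r (z x))
        (weaken (≤2^suc r) (isSquare (poly-+ (polyConst 1#) (poly-* (polyConst (- (1# + 1#))) (poly-φ r)))))

      certified-a : ∀ r → Certified {n} 0 (λ _ → a r)
      certified-a r = respᶜ
        (λ _ → trans (cong (_* ν) (sym (a≡ (ι N) Nν≡1 r))) (trans (*-assoc (a r) _ _) (trans (cong (a r *_) Nν≡1) (*-identityʳ _))))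
        (natural (4 ℕ.^ r) ⊠ reciprocal N Nν≡1)

      certified-K : ∀ r → Certified (2 ℕ.^ r) (λ x → K r (z x))
      certified-K zero    = respᶜ (λ _ → *-identityˡ 1#) (weaken z≤n (constSquare 1#))
      certified-K (suc r) = cast (2^suc r) (certified-K r ⊠ certified-coφ r)

      certified-Q : ∀ r → Certified (2 ℕ.^ r) (λ x → Q r (z x))
      certified-Q zero    = weaken z≤n (natural 0)
      certified-Q (suc r) = weaken (≤2^suc r) (certified-a r ⊠ certified-K r)
        ⊞ cast (2^suc r) (certified-coφ r ⊠ certified-Q r)

      module _ (r B J P : ℕ) where
        open Identity r (ι N) (ι B) (ι J) (ι P)

        private
          one : Certified {n} 0 (λ _ → 1#)
          one = respᶜ (λ _ → *-identityˡ 1#) (constSquare 1#)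

          u = 2 ℕ.^ r

          certified-P² : Certified {n} 0 (λ _ → ι P * ι P)
          certified-P² = constSquare (ι P)

          certified-K² : Certified (4 ℕ.* u) (λ x → K (suc r) (z x) * K (suc r) (z x))
          certified-K² = cast (eq u) (certified-K (suc r) ⊠ certified-K (suc r))
            where
            eq : ∀ u → 2 ℕ.* u ℕ.+ 2 ℕ.* u ≡ 4 ℕ.* u
            eq = ℕ-solve

        certified-w : Certified (4 ℕ.* u) (λ x → w (z x))
        certified-w = certified-P² ⊠ certified-K²

        -- The degree is set by K (r + 1)² and by (1 - φ) · Q · (1 + K (r + 1)), both of degree 4u;
        -- the remaining products stay within 3u and are weakened.
        certified-τ : Certified (4 ℕ.* u) (λ x → τ (z x))
        certified-τ =
          weaken (ℕ.≤-trans (ℕ.m≤n+m _ u) (ℕ.≤-reflexive (eq₁ u))) (certified-a r ⊠ certified-K r ⊠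
            (weaken z≤n (natural B) ⊞ natural N ⊠ natural N ⊠
              (weaken (ℕ.m≤m+n u u) (certified-coφ r)
                ⊞ (isSquare (poly-φ r) ⊠ (one′ ⊞ certified-coφ r)))))
          ⊞ certified-P² ⊠ (natural J ⊠ (one ⊞ natural J)) ⊠
            (weaken (ℕ.≤-trans (ℕ.m≤n+m _ u) (ℕ.≤-reflexive (eq₂ u))) (certified-a r ⊠ certified-K r ⊠ certified-K (suc r))
             ⊞ cast (eq₃ u) (certified-coφ r ⊠ certified-Q r ⊠ (weaken z≤n one ⊞ certified-K (suc r))))
          ⊞ certified-P² ⊠ (natural J ⊞ (one ⊞ natural J)) ⊠ certified-K²
          where
          one′ : Certified {n} u (λ _ → 1#)
          one′ = weaken z≤n one
          eq₁ : ∀ u → u ℕ.+ (u ℕ.+ (u ℕ.+ u)) ≡ 4 ℕ.* u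
          eq₁ = ℕ-solve
          eq₂ : ∀ u → u ℕ.+ (u ℕ.+ 2 ℕ.* u) ≡ 4 ℕ.* u
          eq₂ = ℕ-solve
          eq₃ : ∀ u → u ℕ.+ u ℕ.+ 2 ℕ.* u ≡ 4 ℕ.* u
          eq₃ = ℕ-solve

  -- The start and the step of the descending induction.

  module _ {n : ℕ} where

    t : Fun n
    t = ⟦ sumVars n ⟧

    poly-q : ∀ k → IsPoly 2 ⟦ q n k ⟧
    poly-q k = poly-* (poly-+ (polyVarSum (allFin n)) (polyConst (- ι k)))
                      (poly-+ (poly-+ (polyVarSum (allFin n)) (polyConst (- ι k))) (polyConst 1#))

    -- The condition n ≤ 4^r · j is what makes `B` nonnegative, so 2^r of order √(n/j) is enough; 2
    -- + i ≤ d leaves room for the term q² · (t)ᵢ.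
    step : ∀ {d} i j r .{{_ : ℕ.NonZero n}} .{{_ : ℕ.NonZero j}} → n ℕ.≤ 4 ℕ.^ r ℕ.* j → 2 ℕ.+ i ℕ.≤ d →
      Certified d (λ x → ⟦ q n (suc (i ℕ.+ j)) ⟧ x * fall (suc i) (t x)) →
      Certified (4 ℕ.* 2 ℕ.^ r ℕ.+ d) (λ x → ⟦ q n (suc (i ℕ.+ j)) ⟧ x * fall i (t x))
    step {d} i j r n≤Pj 2+i≤d F with ι-inverse n
    ... | ν , nν≡1 = divide M (respᶜ identity
        (certified-τ z-poly n nν≡1 z≤n′ r B j P ⊠ F
         ⊞ certified-w z-poly n nν≡1 z≤n′ r B j P ⊠ weaken 2+i≤d (isSquare (poly-q (suc (i ℕ.+ j))) ⊠ certifiedFall (allFin n) i)))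
      where
      open Kernel ν
      P M B : ℕ
      P = 4 ℕ.^ r
      M = P ℕ.* P ℕ.* (j ℕ.* suc j)
      -- The truncated subtraction is exact by `n²≤M`.
      B = M ℕ.∸ n ℕ.* n
      open Identity r (ι n) (ι B) (ι j) (ι P)
      instance
        P≢0 : ℕ.NonZero P
        P≢0 = ℕ.m^n≢0 4 r
        P²≢0 : ℕ.NonZero (P ℕ.* P)
        P²≢0 = ℕ.m*n≢0 P P
        j²≢0 : ℕ.NonZero (j ℕ.* suc j)
        j²≢0 = ℕ.m*n≢0 j (suc j)
        M≢0 : ℕ.NonZero M
        M≢0 = ℕ.m*n≢0 (P ℕ.* P) (j ℕ.* suc j)

      n²≤M : n ℕ.* n ℕ.≤ M
      n²≤M = begin
        n ℕ.* n                     ≤⟨ ℕ.*-mono-≤ n≤Pj n≤Pj ⟩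
        (P ℕ.* j) ℕ.* (P ℕ.* j)     ≡⟨ rearrange P j ⟩
        P ℕ.* P ℕ.* (j ℕ.* j)       ≤⟨ ℕ.*-monoʳ-≤ (P ℕ.* P) (ℕ.*-monoʳ-≤ j (ℕ.n≤1+n j)) ⟩
        M                           ∎
        where
        open ℕ.≤-Reasoning
        rearrange : ∀ P j → (P ℕ.* j) ℕ.* (P ℕ.* j) ≡ P ℕ.* P ℕ.* (j ℕ.* j)
        rearrange = ℕ-solve

      ιM : ι M ≡ ι P * ι P * (ι j * (1# + ι j))
      ιM = trans (ι-* (P ℕ.* P) (j ℕ.* suc j)) (cong₂ _*_ (ι-* P P) (ι-* j (suc j)))

      ιB : ι P * ι P * (ι j * (1# + ι j)) ≡ ι n * ι n + ι B
      ιB = trans (sym ιM) (trans (cong ι (sym (ℕ.m+[n∸m]≡n n²≤M))) (trans (ι-+ (n ℕ.* n) B) (cong (_+ ι B) (ι-* n n))))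

      z : Fun n
      z x = t x + - ι i

      z-poly : IsPoly 1 z
      z-poly = poly-+ (polyVarSum (allFin n)) (polyConst (- ι i))

      z≤n′ : Certified 1 (λ x → ι n + - z x)
      z≤n′ = respᶜ (λ x → solve 3 (λ n t i → n :- t :+ i := n :- (t :- i)) refl (ι n) (t x) (ι i))
        (certifiedComplement ⊞ weaken z≤n (natural i))

      q≡ : ∀ x → ⟦ q n (suc (i ℕ.+ j)) ⟧ x ≡ (z x + - ι j) * (z x + - ι j + - 1#)
      q≡ x = trans (cong (λ c → (t x + - (1# + c)) * (t x + - (1# + c) + 1#)) (ι-+ i j))
        (solve 3 (λ t i j → (t :- (lit 1 :+ (i :+ j))) :* (t :- (lit 1 :+ (i :+ j)) :+ lit 1)
                        := (t :- i :- j) :* (t :- i :- j :- lit 1)) refl (t x) (ι i) (ι j))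

      identity : ∀ x → τ (z x) * (⟦ q n (suc (i ℕ.+ j)) ⟧ x * fall (suc i) (t x))
                     + w (z x) * (⟦ q n (suc (i ℕ.+ j)) ⟧ x * ⟦ q n (suc (i ℕ.+ j)) ⟧ x * fall i (t x))
                     ≡ ι M * (⟦ q n (suc (i ℕ.+ j)) ⟧ x * fall i (t x))
      identity x = trans
        (solve 5 (λ τ w q z f → τ :* (q :* (z :* f)) :+ w :* (q :* q :* f) := (z :* τ :+ q :* w) :* (q :* f)) refl
          (τ (z x)) (w (z x)) (⟦ q n (suc (i ℕ.+ j)) ⟧ x) (z x) (fall i (t x)))
        (cong (_* (⟦ q n (suc (i ℕ.+ j)) ⟧ x * fall i (t x)))
          (trans (cong (λ y → z x * τ (z x) + y * w (z x)) (q≡ x))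
            (trans (z*τ+q*w (a≡ (ι n) nν≡1 r) ιB (z x)) (sym ιM))))

    base : ∀ m → Certified (2 ℕ.+ m) (λ x → ⟦ q n (suc m) ⟧ x * fall m (t x))
    base m = respᶜ (λ x → solve 3 (λ t m f → (t :- (lit 1 :+ m)) :* ((t :- m) :* f) := (t :- (lit 1 :+ m)) :* (t :- (lit 1 :+ m) :+ lit 1) :* f)
                            refl (t x) (ι m) (fall m (t x)))
      (certifiedFall (allFin n) (2 ℕ.+ m))

-- Degree estimates in the natural numbers.

open import Data.Nat using (_+_; _≤_; _*_; _^_)
open import Data.Nat.Logarithm using (⌈log₂_⌉; ⌈log₂⌉-mono-≤)
open ℕ.≤-Reasoning

-- Rounding n/j up to a power of 4 loses at most a factor 4: as n grows from j, r is raised only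
-- when n equals 4^r · j, and then 4^(r+1) · j = 4n.
∃4^ : ∀ {j n} → 1 ≤ j → j ≤′ n → ∃ λ r → n ≤ 4 ^ r * j × 4 ^ r * j ≤ 4 * n
∃4^ {j} _ (≤′-reflexive refl) = 0 , ℕ.m≤m+n j 0 , ℕ.*-monoˡ-≤ j (ℕ.m≤m+n 1 3)
∃4^ {j} 1≤j (≤′-step {n} j≤n) with ∃4^ 1≤j j≤n
... | r , n≤ , ≤4n with ℕ.m≤n⇒m<n∨m≡n n≤
...   | inj₁ n< = r , n< , ℕ.≤-trans ≤4n (ℕ.*-monoʳ-≤ 4 (ℕ.n≤1+n n))
...   | inj₂ n≡ = suc r , lower , upper
  where
  4n≡ : 4 * n ≡ 4 ^ suc r * j
  4n≡ = trans (cong (4 *_) n≡) (sym (ℕ.*-assoc 4 (4 ^ r) j))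
  lower : suc n ≤ 4 ^ suc r * j
  lower = begin
    suc n         ≤⟨ ℕ.+-monoˡ-≤ n (ℕ.≤-trans 1≤j (ℕ.≤′⇒≤ j≤n)) ⟩
    n + n         ≤⟨ ℕ.+-monoʳ-≤ n (ℕ.m≤m+n n _) ⟩
    4 * n         ≡⟨ 4n≡ ⟩
    4 ^ suc r * j ∎
  upper : 4 ^ suc r * j ≤ 4 * suc n
  upper = ℕ.≤-trans (ℕ.≤-reflexive (sym 4n≡)) (ℕ.*-monoʳ-≤ 4 (ℕ.n≤1+n n))

4^≡2^*2^ : ∀ r → 4 ^ r ≡ 2 ^ r * 2 ^ r
4^≡2^*2^ zero    = refl
4^≡2^*2^ (suc r) = trans (cong (4 *_) (4^≡2^*2^ r)) (regroup (2 ^ r))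
  where
  regroup : ∀ u → 4 * (u * u) ≡ 2 * u * (2 * u)
  regroup = ℕ-solve

2xy≤x²+y² : ∀ x y → 2 * (x * y) ≤ x * x + y * y
2xy≤x²+y² x y with ℕ.≤-total x y
... | inj₁ x≤y with ℕ.m≤n⇒∃[o]m+o≡n x≤y
...   | k , refl = ℕ.≤-trans (ℕ.m≤m+n _ (k * k)) (ℕ.≤-reflexive (eq x k))
  where
  eq : ∀ x k → 2 * (x * (x + k)) + k * k ≡ x * x + (x + k) * (x + k)
  eq = ℕ-solve
2xy≤x²+y² x y | inj₂ y≤x with ℕ.m≤n⇒∃[o]m+o≡n y≤x
...   | k , refl = ℕ.≤-trans (ℕ.m≤m+n _ (k * k)) (ℕ.≤-reflexive (eq y k))
  where
  eq : ∀ y k → 2 * ((y + k) * y) + k * k ≡ (y + k) * (y + k) + y * y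
  eq = ℕ-solve

-- Summing a ≤ 2√(n/j) over j ≤ m gives O(√(nm)); the constant 24 makes the induction on m close after
-- the cross term 2as has been split by AM-GM.
sum-bound : ∀ n m a s → s * s ≤ 24 * (n * m) → a * a * suc m ≤ 4 * n → (a + s) * (a + s) ≤ 24 * (n * suc m)
sum-bound n m a s s²≤ a²≤ = ℕ.*-cancelˡ-≤ (2 * suc m) (begin
  2 * suc m * ((a + s) * (a + s))
    ≡⟨ expand m a s ⟩
  2 * suc m * (s * s) + 2 * (2 * (a * suc m) * s) + 2 * (a * a * suc m)
    ≤⟨ ℕ.+-monoˡ-≤ (2 * (a * a * suc m)) (ℕ.+-monoʳ-≤ (2 * suc m * (s * s)) (2xy≤x²+y² (2 * (a * suc m)) s)) ⟩
  2 * suc m * (s * s) + (2 * (a * suc m) * (2 * (a * suc m)) + s * s) + 2 * (a * a * suc m)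
    ≡⟨ collect m a s ⟩
  (2 * m + 3) * (s * s) + (4 * m + 6) * (a * a * suc m)
    ≤⟨ ℕ.+-mono-≤ (ℕ.*-monoʳ-≤ (2 * m + 3) s²≤) (ℕ.*-monoʳ-≤ (4 * m + 6) a²≤) ⟩
  (2 * m + 3) * (24 * (n * m)) + (4 * m + 6) * (4 * n)
    ≤⟨ ℕ.m≤m+n _ (8 * (n * m) + 24 * n) ⟩
  (2 * m + 3) * (24 * (n * m)) + (4 * m + 6) * (4 * n) + (8 * (n * m) + 24 * n)
    ≡⟨ total n m ⟩
  2 * suc m * (24 * (n * suc m)) ∎)
  where
  expand : ∀ m a s → 2 * suc m * ((a + s) * (a + s)) ≡ 2 * suc m * (s * s) + 2 * (2 * (a * suc m) * s) + 2 * (a * a * suc m)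
  expand = ℕ-solve
  collect : ∀ m a s → 2 * suc m * (s * s) + (2 * (a * suc m) * (2 * (a * suc m)) + s * s) + 2 * (a * a * suc m)
                    ≡ (2 * m + 3) * (s * s) + (4 * m + 6) * (a * a * suc m)
  collect = ℕ-solve
  total : ∀ n m → (2 * m + 3) * (24 * (n * m)) + (4 * m + 6) * (4 * n) + (8 * (n * m) + 24 * n) ≡ 2 * suc m * (24 * (n * suc m))
  total = ℕ-solve

-- AM-GM separates s from 2 + m, giving 128s² + 8(2 + m)². With k = m + 1, 2 + m ≤ 2k and k ≤ n, the
-- constant is 128 · 24 + 8 · 4 = 3104.
degree-bound : ∀ n m s → suc m ≤ n → s * s ≤ 24 * (n * m) →
  2 * (4 * s + (2 + m)) * (2 * (4 * s + (2 + m))) ≤ 3104 * (n * suc m)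
degree-bound n m s k≤n s²≤ = begin
  2 * (4 * s + (2 + m)) * (2 * (4 * s + (2 + m)))
    ≡⟨ expand s (2 + m) ⟩
  64 * (s * s) + 4 * ((2 + m) * (2 + m)) + 4 * (2 * (4 * s * (2 + m)))
    ≤⟨ ℕ.+-monoʳ-≤ (64 * (s * s) + 4 * ((2 + m) * (2 + m))) (ℕ.*-monoʳ-≤ 4 (2xy≤x²+y² (4 * s) (2 + m))) ⟩
  64 * (s * s) + 4 * ((2 + m) * (2 + m)) + 4 * (4 * s * (4 * s) + (2 + m) * (2 + m))
    ≡⟨ collect s (2 + m) ⟩
  128 * (s * s) + 8 * ((2 + m) * (2 + m))
    ≤⟨ ℕ.+-mono-≤ (ℕ.*-monoʳ-≤ 128 s²≤) (ℕ.*-monoʳ-≤ 8 (ℕ.*-mono-≤ 2+m≤2k 2+m≤2k)) ⟩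
  128 * (24 * (n * m)) + 8 * (2 * suc m * (2 * suc m))
    ≤⟨ ℕ.+-mono-≤ (ℕ.*-monoʳ-≤ 128 (ℕ.*-monoʳ-≤ 24 (ℕ.*-monoʳ-≤ n (ℕ.n≤1+n m))))
                  (ℕ.*-monoʳ-≤ 8 (ℕ.*-monoˡ-≤ (2 * suc m) (ℕ.*-monoʳ-≤ 2 k≤n))) ⟩
  128 * (24 * (n * suc m)) + 8 * (2 * n * (2 * suc m))
    ≡⟨ total n (suc m) ⟩
  3104 * (n * suc m) ∎
  where
  2+m≤2k : 2 + m ≤ 2 * suc m
  2+m≤2k = begin
    2 + m             ≤⟨ ℕ.m≤m+n (2 + m) m ⟩
    2 + m + m         ≡⟨ eq m ⟩
    2 * suc m         ∎
    where
    eq : ∀ m → 2 + m + m ≡ 2 * suc m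
    eq = ℕ-solve
  expand : ∀ s k → 2 * (4 * s + k) * (2 * (4 * s + k)) ≡ 64 * (s * s) + 4 * (k * k) + 4 * (2 * (4 * s * k))
  expand = ℕ-solve
  collect : ∀ s k → 64 * (s * s) + 4 * (k * k) + 4 * (4 * s * (4 * s) + k * k) ≡ 128 * (s * s) + 8 * (k * k)
  collect = ℕ-solve
  total : ∀ n k → 128 * (24 * (n * k)) + 8 * (2 * n * (2 * k)) ≡ 3104 * (n * k)
  total = ℕ-solve

-- The descent and the final degree.

module _ (R : RealField) where
  open SymmetricCertificates R using (Certified; ⟦_⟧; q; fall; t; step; base; cast)

  -- Here s adds up the values 2^r over the j steps between i and m. Bounding s² rather than s
  -- expresses s = O(√(nj)) within ℕ.
  descent : ∀ n m → m ≤ n → ∀ j i → i + j ≡ m →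
    ∃ λ s → s * s ≤ 24 * (n * j) ×
      Certified {n} (4 * s + (2 + m)) (λ x → RealField._*_ R (⟦ q n (suc m) ⟧ x) (fall i (t x)))
  descent n m m≤n zero i i+0≡m with trans (sym (ℕ.+-identityʳ i)) i+0≡m
  ... | refl = 0 , z≤n , base m
  descent n m m≤n (suc j) i refl
    with descent n m m≤n j (suc i) (sym (ℕ.+-suc i j)) | ∃4^ (s≤s z≤n) (ℕ.≤⇒≤′ (ℕ.≤-trans (ℕ.m≤n+m (suc j) i) m≤n))
  ... | s , s²≤ , F | r , n≤ , ≤4n =
    2 ^ r + s ,
    sum-bound n j (2 ^ r) s s²≤ (subst (λ u → u * suc j ≤ 4 * n) (4^≡2^*2^ r) ≤4n) ,
    cast (regroup (2 ^ r) s (2 + m))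
      (step i (suc j) r {{ℕ.>-nonZero (ℕ.≤-trans (s≤s z≤n) j<n)}} n≤
        (ℕ.m≤n⇒m≤o+n (4 * s) (ℕ.+-monoʳ-≤ 2 (ℕ.m≤m+n i (suc j)))) F)
    where
    j<n : suc j ≤ n
    j<n = ℕ.≤-trans (ℕ.m≤n+m (suc j) i) m≤n
    regroup : ∀ u s c → 4 * u + (4 * s + c) ≡ 4 * (u + s) + c
    regroup = ℕ-solve

theorem1 : (R : RealField) → let open Poly R in
    ∃ λ (C : ℕ) → ∀ (n k : ℕ) → 1 ≤ n → 2 ≤ k → k ≤ ⌈ n /2⌉ →
    ∃ λ (d : ℕ) → (d * d ≤ C * (n * k * (⌈log₂ n ⌉ ^ 2))) ×
    InQM n (H n) d ⟦ q n k ⟧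
theorem1 R = 3104 , certificate
  where
  open SymmetricCertificates R using (⟦_⟧; q; H; InQM; respᶜ; certified⇒InQM; *-identityʳ)
  certificate : ∀ (n k : ℕ) → 1 ≤ n → 2 ≤ k → k ≤ ⌈ n /2⌉ →
    ∃ λ (d : ℕ) → (d * d ≤ 3104 * (n * k * (⌈log₂ n ⌉ ^ 2))) × InQM n (H n) d ⟦ q n k ⟧
  certificate n (suc m) _ (s≤s 1≤m) k≤⌈n/2⌉
    -- At i = 0 the falling factorial is 1, so the certificate is one of q itself.
    with descent R n m (ℕ.≤-trans (ℕ.n≤1+n m) (ℕ.≤-trans k≤⌈n/2⌉ (ℕ.⌈n/2⌉≤n n))) m 0 refl
  ... | s , s²≤ , F = 2 * (4 * s + (2 + m)) , bound , certified⇒InQM (respᶜ (λ x → *-identityʳ _) F)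
    where
    k≤n = ℕ.≤-trans k≤⌈n/2⌉ (ℕ.⌈n/2⌉≤n n)
    -- From 2 ≤ k ≤ n the logarithm is at least 1, so the bound 3104nk on the squared degree only
    -- grows when multiplied by its square.
    1≤log : 1 ≤ ⌈log₂ n ⌉
    1≤log = ⌈log₂⌉-mono-≤ (ℕ.≤-trans (s≤s 1≤m) k≤n)
    bound : 2 * (4 * s + (2 + m)) * (2 * (4 * s + (2 + m))) ≤ 3104 * (n * suc m * (⌈log₂ n ⌉ ^ 2))
    bound = begin
      2 * (4 * s + (2 + m)) * (2 * (4 * s + (2 + m))) ≤⟨ degree-bound n m s k≤n s²≤ ⟩
      3104 * (n * suc m)                              ≡⟨ cong (3104 *_) (sym (ℕ.*-identityʳ (n * suc m))) ⟩
      3104 * (n * suc m * 1)                          ≤⟨ ℕ.*-monoʳ-≤ 3104 (ℕ.*-monoʳ-≤ (n * suc m) (ℕ.^-monoˡ-≤ 2 1≤log)) ⟩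
      3104 * (n * suc m * (⌈log₂ n ⌉ ^ 2))            ∎
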